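{- Let $G_0,G_1\in\mathbb{Z}$, let $(G_n)_{n\ge0}$ satisfy $G_n=G_{n-1}+G_{n-2}$ for $n\ge2$, and let $\mu = G_1^2 - G_0 G_1 - G_0^2$. Let $k \geq 1$ be odd and set $\ell_k = \gcd(G_{k+1} - G_1,\, G_{k+2} - G_2)$. If $2\mu$ divides $\ell_k$, then $\mathcal{G}^2_{G_0,G_1}(k\ell) = |2\mu|$ for all odd integers $\ell \geq 1$.
   Context: $\mathcal{G}^2_{G_0,G_1}(m)=\gcd\{\sum_{i=1}^m G_{n+i}^2 : n\ge 0\}$ (nonnegative gcd of this infinite set of integers). -}

module Defs where

open import Data.Integer.Base using (ℤ; +_; _+_; _-_; _*_; _^_; 0ℤ)
open import Data.Integer.Divisibility using (_∣_)
open import Data.Integer.GCD using (gcd)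
open import Data.Nat.Base as ℕ using (ℕ; zero; suc; parity)
import Data.Nat.Divisibility as ℕ
open import Data.Parity.Base using (1ℙ)
open import Relation.Binary.PropositionalEquality using (_≡_)

Odd : ℕ → Set
Odd n = parity n ≡ 1ℙ

IsGibonacci : (ℕ → ℤ) → Set
IsGibonacci G = ∀ n → G (2 ℕ.+ n) ≡ G (1 ℕ.+ n) + G n

μ : (ℕ → ℤ) → ℤ
μ G = G 1 ^ 2 - G 0 * G 1 - G 0 ^ 2

ℓ : (ℕ → ℤ) → ℕ → ℤ
ℓ G k = gcd (G (k ℕ.+ 1) - G 1) (G (k ℕ.+ 2) - G 2)

-- ∑₁ m f = f 1 + f 2 + ⋯ + f m; the sum starts at index 1.
∑₁ : ℕ → (ℕ → ℤ) → ℤ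
∑₁ zero    f = 0ℤ
∑₁ (suc m) f = ∑₁ m f + f (suc m)

-- The gcd of an infinite family is given by its defining property, since it
-- cannot be computed for an arbitrary family.  "Greatest" is with respect to
-- divisibility, so the gcd of the zero family is 0; d : ℕ makes the gcd
-- nonnegative, hence unique (IsGCD-unique).
record IsGCD (a : ℕ → ℤ) (d : ℕ) : Set where
  field
    commonDivisor : ∀ n → + d ∣ a n
    greatest      : ∀ {c} → (∀ n → c ∣ a n) → c ∣ + d

IsGCD-unique : ∀ {a d e} → IsGCD a d → IsGCD a e → d ≡ e
IsGCD-unique {d = d} {e} p q = ℕ.∣-antisym
  (IsGCD.greatest q {+ d} (IsGCD.commonDivisor p))
  (IsGCD.greatest p {+ e} (IsGCD.commonDivisor q))

-- 𝒢² G ⟨ m ⟩≔ d reads "gcd { ∑_{i=1}^m G_{n+i}² : n ≥ 0 } equals d".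
𝒢²_⟨_⟩≔_ : (ℕ → ℤ) → ℕ → ℕ → Set
𝒢²_⟨_⟩≔_ G m d = IsGCD (λ n → ∑₁ m (λ i → G (n ℕ.+ i) ^ 2)) d

{-# OPTIONS --safe #-}

-- Put S n = ∑_{i=1}^m G_{n+i}², so that S n = G_{m+n} G_{m+n+1} - G_n G_{n+1}.
-- If 2μ divides ℓ_k, then G has period k modulo 2μ, hence also period m = kl,
-- and 2μ divides every S n.  Conversely, μ changes sign whenever G is shifted
-- by one, so for odd m the quadratic form μ takes opposite values on G and on
-- its shift by m; the difference of these values is a combination of
-- S 0, S 1, S 2, namely 2μ = S 0 + S 2 - 3 S 1.
module Submission where

open import Defs
open import Data.Integer.Base using (ℤ; +_; ∣_∣) renaming (_*_ to _*ℤ_)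
open import Data.Integer.Divisibility using (_∣_)
open import Data.Nat.Base using (ℕ; _*_; _≥_)

open import Data.Integer.Base using (_+_; _-_; -_; _^_)
open import Data.Integer.Divisibility.Signed as Signed
  using (∣ᵤ⇒∣; ∣⇒∣ᵤ; ∣m∣n⇒∣m+n; ∣m∣n⇒∣m-n; ∣m+n∣m⇒∣n; ∣m⇒∣m*n; ∣n⇒∣m*n)
open import Data.Integer.GCD using (gcd[i,j]∣i; gcd[i,j]∣j)
open import Data.Integer.Properties using (neg-involutive; +-inverseʳ)
open import Data.Integer.Tactic.RingSolver using (solve-∀)
open import Data.Nat.Base as ℕ using (zero; suc)
import Data.Nat.Divisibility as ℕ
import Data.Nat.Properties as ℕ
open import Data.Parity.Base as ℙ using ()
open import Data.Parity.Properties using (*-homo-*)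
open import Relation.Binary.PropositionalEquality
  using (_≡_; sym; trans; cong; cong₂; subst; module ≡-Reasoning)

shift : ℕ → (ℕ → ℤ) → ℕ → ℤ
shift m G i = G (m ℕ.+ i)

squareSum : (ℕ → ℤ) → ℕ → ℕ → ℤ
squareSum G m n = ∑₁ m (λ i → G (n ℕ.+ i) ^ 2)

Odd-* : ∀ m n → Odd m → Odd n → Odd (m * n)
Odd-* m n p q = trans (*-homo-* m n) (cong₂ ℙ._*_ p q)

shift-isGibonacci : ∀ G → IsGibonacci G → ∀ m → IsGibonacci (shift m G)
shift-isGibonacci G gib m n
  rewrite ℕ.+-suc m (suc n) | ℕ.+-suc m n = gib (m ℕ.+ n)

difference-isGibonacci : ∀ G H → IsGibonacci G → IsGibonacci H →
                         IsGibonacci (λ n → G n - H n)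
difference-isGibonacci G H gibG gibH n rewrite gibG n | gibH n =
  identity (G (suc n)) (G n) (H (suc n)) (H n)
  where
  identity : ∀ a b c d → (a + b) - (c + d) ≡ (a - c) + (b - d)
  identity = solve-∀

-- The sum telescopes, because G_j² = G_j (G_{j+1} - G_{j-1}). The indices are written `m + n` so
-- that the leading terms are values of `shift m G`.
squareSum-closed : ∀ G → IsGibonacci G → ∀ m n →
  squareSum G m n ≡ G (m ℕ.+ n) *ℤ G (m ℕ.+ suc n) - G n *ℤ G (suc n)
squareSum-closed G gib zero n = sym (+-inverseʳ (G n *ℤ G (suc n)))
squareSum-closed G gib (suc m) n = begin
  squareSum G m n + G (n ℕ.+ suc m) ^ 2
    ≡⟨ cong₂ (λ s j → s + G j ^ 2) (squareSum-closed G gib m n) n+1+m≡m+1+n ⟩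
  (a *ℤ b - c) + b ^ 2
    ≡⟨ identity a b c ⟩
  b *ℤ (b + a) - c
    ≡⟨ cong (λ x → b *ℤ x - c) (shift-isGibonacci G gib m n) ⟨
  b *ℤ G (m ℕ.+ suc (suc n)) - c
    ≡⟨ cong₂ (λ i j → G i *ℤ G j - c) (ℕ.+-suc m n) (ℕ.+-suc m (suc n)) ⟩
  G (suc m ℕ.+ n) *ℤ G (suc m ℕ.+ suc n) - c ∎
  where
  open ≡-Reasoning
  a = G (m ℕ.+ n)
  b = G (m ℕ.+ suc n)
  c = G n *ℤ G (suc n)
  n+1+m≡m+1+n : n ℕ.+ suc m ≡ m ℕ.+ suc n
  n+1+m≡m+1+n = trans (ℕ.+-comm n (suc m)) (sym (ℕ.+-suc m n))
  -- b *ℤ (b *ℤ + 1) is the unfolding of b ^ 2.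
  identity : ∀ a b c → (a *ℤ b - c) + b *ℤ (b *ℤ + 1) ≡ b *ℤ (b + a) - c
  identity = solve-∀

-- Cassini's identity in disguise: `μ G` is G_1² - G_0 G_2.
μ-shift₁ : ∀ G → IsGibonacci G → μ (shift 1 G) ≡ - μ G
μ-shift₁ G gib rewrite gib 0 = identity (G 0) (G 1)
  where
  identity : ∀ a b →
    (b + a) *ℤ ((b + a) *ℤ + 1) - b *ℤ (b + a) - b *ℤ (b *ℤ + 1)
    ≡ - (b *ℤ (b *ℤ + 1) - a *ℤ b - a *ℤ (a *ℤ + 1))
  identity = solve-∀

μ-shift₂ : ∀ G → IsGibonacci G → μ (shift 2 G) ≡ μ G
μ-shift₂ G gib = begin
  μ (shift 2 G)    ≡⟨ μ-shift₁ (shift 1 G) (shift-isGibonacci G gib 1) ⟩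
  - μ (shift 1 G)  ≡⟨ cong (λ x → - x) (μ-shift₁ G gib) ⟩
  - (- μ G)        ≡⟨ neg-involutive (μ G) ⟩
  μ G              ∎
  where open ≡-Reasoning

μ-shift-odd : ∀ G → IsGibonacci G → ∀ m → Odd m → μ (shift m G) ≡ - μ G
μ-shift-odd G gib 1 _ = μ-shift₁ G gib
-- Parity is computed in steps of two, so `odd` serves for `m` unchanged.
μ-shift-odd G gib (suc (suc m)) odd = trans
  (μ-shift-odd (shift 2 G) (shift-isGibonacci G gib 2) m odd)
  (cong (λ x → - x) (μ-shift₂ G gib))

-- For every Gibonacci sequence, G_0 G_1 + G_2 G_3 - 3 G_1 G_2 = -μ. By the closed form, the
-- right-hand side is this expression for `shift m G` minus the same one for `G`.
2μ-combination : ∀ G → IsGibonacci G → ∀ m → Odd m →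
  + 2 *ℤ μ G ≡ squareSum G m 0 + squareSum G m 2 - + 3 *ℤ squareSum G m 1
2μ-combination G gib m odd = begin
  + 2 *ℤ μ G     ≡⟨ double (μ G) ⟩
  μ G - (- μ G)  ≡⟨ cong (λ x → μ G - x) (μ-shift-odd G gib m odd) ⟨
  μ G - μ H      ≡⟨ identity (G 0) (G 1) (H 0) (H 1) ⟩
  combination (G 1 + G 0) ((G 1 + G 0) + G 1) (H 1 + H 0) ((H 1 + H 0) + H 1)
    ≡⟨ cong₂ (λ x y → combination x (x + G 1) y (y + H 1)) (gib 0) (gibH 0) ⟨
  combination (G 2) (G 2 + G 1) (H 2) (H 2 + H 1)
    ≡⟨ cong₂ (λ x y → combination (G 2) x (H 2) y) (gib 1) (gibH 1) ⟨
  combination (G 2) (G 3) (H 2) (H 3)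
    ≡⟨ cong₂ (λ x y → x - + 3 *ℤ y)
         (cong₂ _+_ (squareSum-closed G gib m 0) (squareSum-closed G gib m 2))
         (squareSum-closed G gib m 1) ⟨
  squareSum G m 0 + squareSum G m 2 - + 3 *ℤ squareSum G m 1 ∎
  where
  open ≡-Reasoning
  H = shift m G
  gibH = shift-isGibonacci G gib m
  combination : ℤ → ℤ → ℤ → ℤ → ℤ
  combination G₂ G₃ H₂ H₃ =
    (H 0 *ℤ H 1 - G 0 *ℤ G 1) + (H₂ *ℤ H₃ - G₂ *ℤ G₃)
      - + 3 *ℤ (H 1 *ℤ H₂ - G 1 *ℤ G₂)
  double : ∀ x → + 2 *ℤ x ≡ x - (- x)
  double = solve-∀
  identity : ∀ a b c d →
    (b *ℤ (b *ℤ + 1) - a *ℤ b - a *ℤ (a *ℤ + 1))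
      - (d *ℤ (d *ℤ + 1) - c *ℤ d - c *ℤ (c *ℤ + 1))
    ≡ (c *ℤ d - a *ℤ b) + ((d + c) *ℤ ((d + c) + d) - (b + a) *ℤ ((b + a) + b))
      - + 3 *ℤ (d *ℤ (d + c) - b *ℤ (b + a))
  identity = solve-∀

module _ {d : ℤ} where

  ∣-gibonacci : ∀ H → IsGibonacci H → d Signed.∣ H 0 → d Signed.∣ H 1 →
                ∀ n → d Signed.∣ H n
  ∣-gibonacci H gib d∣H₀ d∣H₁ zero = d∣H₀
  ∣-gibonacci H gib d∣H₀ d∣H₁ (suc n) =
    -- Shifting `H` instead of strengthening the claim keeps two consecutive terms available.
    ∣-gibonacci (shift 1 H) (shift-isGibonacci H gib 1) d∣H₁
      (subst (d Signed.∣_) (sym (gib 0)) (∣m∣n⇒∣m+n d∣H₁ d∣H₀)) n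

  Period : (ℕ → ℤ) → ℕ → Set
  Period G k = ∀ n → d Signed.∣ G (k ℕ.+ n) - G n

  Period-ℓ : ∀ G → IsGibonacci G → ∀ k → d ∣ ℓ G k → Period G k
  Period-ℓ G gib k d∣ℓ = ∣-gibonacci D gibD d∣D₀ d∣D₁
    where
    D : ℕ → ℤ
    D n = G (k ℕ.+ n) - G n
    gibD : IsGibonacci D
    gibD = difference-isGibonacci (shift k G) G (shift-isGibonacci G gib k) gib
    d∣D₁ : d Signed.∣ D 1
    d∣D₁ = ∣ᵤ⇒∣ (ℕ.∣-trans d∣ℓ (gcd[i,j]∣i (D 1) (D 2)))
    d∣D₂ : d Signed.∣ D 2
    d∣D₂ = ∣ᵤ⇒∣ (ℕ.∣-trans d∣ℓ (gcd[i,j]∣j (D 1) (D 2)))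
    -- `ℓ` controls only the indices 1 and 2; index 0 comes from running the recurrence backwards.
    d∣D₀ : d Signed.∣ D 0
    d∣D₀ = ∣m+n∣m⇒∣n (subst (d Signed.∣_) (gibD 0) d∣D₂) d∣D₁

  Period-* : ∀ G k l → Period G k → Period G (l * k)
  Period-* G k zero    per n =
    subst (d Signed.∣_) (sym (+-inverseʳ (G n))) (∣ᵤ⇒∣ (∣ d ∣ ℕ.∣0))
  Period-* G k (suc l) per n =
    subst (d Signed.∣_) telescope
      (∣m∣n⇒∣m+n (per (l * k ℕ.+ n)) (Period-* G k l per n))
    where
    identity : ∀ a b c → (a - b) + (b - c) ≡ a - c
    identity = solve-∀
    telescope : (G (k ℕ.+ (l * k ℕ.+ n)) - G (l * k ℕ.+ n)) + (G (l * k ℕ.+ n) - G n)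
                ≡ G (suc l * k ℕ.+ n) - G n
    telescope = trans (identity (G (k ℕ.+ (l * k ℕ.+ n))) (G (l * k ℕ.+ n)) (G n))
      (cong (λ j → G j - G n) (sym (ℕ.+-assoc k (l * k) n)))

  -- Modulo `d` the two products in the closed form have congruent factors, so they cancel.
  Period⇒∣squareSum : ∀ G → IsGibonacci G → ∀ m → Period G m →
                      ∀ n → d Signed.∣ squareSum G m n
  Period⇒∣squareSum G gib m per n =
    subst (d Signed.∣_)
      (trans (identity (G (m ℕ.+ n)) (G (m ℕ.+ suc n)) (G n) (G (suc n)))
             (sym (squareSum-closed G gib m n)))
      (∣m∣n⇒∣m+n (∣m⇒∣m*n (G (m ℕ.+ suc n)) (per n))
                 (∣n⇒∣m*n (G n) (per (suc n))))
    where
    identity : ∀ a b c e → (a - c) *ℤ b + c *ℤ (b - e) ≡ a *ℤ b - c *ℤ e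
    identity = solve-∀

theorem4p11 : (G : ℕ → ℤ) → IsGibonacci G →
    (k : ℕ) → k ≥ 1 → Odd k →
    (+ 2) *ℤ μ G ∣ ℓ G k →
    ∀ l → l ≥ 1 → Odd l →
    𝒢² G ⟨ k * l ⟩≔ ∣ (+ 2) *ℤ μ G ∣
theorem4p11 G gib k _ odd-k 2μ∣ℓ l _ odd-l = record
  -- Unsigned divisibility sees only absolute values, so `∣ + 2 *ℤ μ G ∣` and `+ 2 *ℤ μ G` are
  -- interchangeable here, whatever the sign of `μ G`.
  { commonDivisor = λ n → ∣⇒∣ᵤ {+ 2 *ℤ μ G} {squareSum G m n}
                            (Period⇒∣squareSum G gib m period n)
  ; greatest      = λ {c} c∣S → ∣⇒∣ᵤ {c} {+ 2 *ℤ μ G}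
                                  (∣S⇒∣2μ λ n → ∣ᵤ⇒∣ {c} {squareSum G m n} (c∣S n))
  }
  where
  m = k * l
  period : Period {+ 2 *ℤ μ G} G m
  period = subst (Period G) (ℕ.*-comm l k)
             (Period-* G k l (Period-ℓ G gib k 2μ∣ℓ))
  ∣S⇒∣2μ : ∀ {c} → (∀ n → c Signed.∣ squareSum G m n) → c Signed.∣ + 2 *ℤ μ G
  ∣S⇒∣2μ {c} c∣S =
    -- Three values of n already force any common divisor to divide 2μ.
    subst (c Signed.∣_) (sym (2μ-combination G gib m (Odd-* k l odd-k odd-l)))
      (∣m∣n⇒∣m-n (∣m∣n⇒∣m+n (c∣S 0) (c∣S 2)) (∣n⇒∣m*n (+ 3) (c∣S 1)))
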